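{- Let $G$ be a finite non-bipartite graph and let $r,s,p,q$ be non-negative integers with $\frac{2r+1}{2s+1}<\frac{2p+1}{2q+1}<og(G)$. Then $G^{\frac{2r+1}{2s+1}}<G^{\frac{2p+1}{2q+1}}$, i.e., $G^{\frac{2r+1}{2s+1}}\longrightarrow G^{\frac{2p+1}{2q+1}}$ and there is no homomorphism from $G^{\frac{2p+1}{2q+1}}$ to $G^{\frac{2r+1}{2s+1}}$.
   Context: All graphs are finite. $G\longrightarrow H$ means there is a homomorphism (adjacency-preserving vertex map) from $G$ to $H$. $og(G)$ is the odd girth of $G$. For a positive integer $k$, $G^{k}$ has vertex set $V(G)$, with $u,v$ adjacent iff there is a walk of length $k$ between them in $G$ (loops allowed). $S_t(G)$ is obtained from $G$ by replacing each edge by a path with exactly $t-1$ inner vertices, and for non-negative integers $r,s$, $G^{\frac{2r+1}{2s+1}}:=(S_{2s+1}(G))^{2r+1}$. -}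

module Defs where

open import Data.Nat using (ℕ; zero; suc; _+_; _*_; _∸_; _≤_; _<_)
open import Data.Nat.Properties using ()
open import Data.Fin as Fin using (Fin; toℕ; inject₁; fromℕ)
open import Data.Bool using (Bool; true; false)
open import Data.Product using (Σ; _×_; _,_; ∃)
open import Data.Sum using (_⊎_)
open import Function.Definitions using (Injective)
open import Relation.Binary.PropositionalEquality using (_≡_; _≢_)
open import Relation.Nullary using (¬_)
open import Data.Integer using (+_)
open import Data.Rational.Unnormalised using (ℚᵘ; mkℚᵘ)

record Graph : Set₁ where
  field
    V : Set
    E : V → V → Set
open Graph public

_⟶_ : Graph → Graph → Set
G ⟶ H = Σ (V G → V H) λ f → ∀ {x y} → E G x y → E H (f x) (f y)

data Walk (G : Graph) : ℕ → V G → V G → Set where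
  nil  : ∀ {x} → Walk G 0 x x
  cons : ∀ {k x y z} → E G x y → Walk G k y z → Walk G (suc k) x z

_^^_ : Graph → ℕ → Graph
G ^^ k = record { V = V G ; E = Walk G k }

record FinGraph : Set where
  field
    n     : ℕ
    adj   : Fin n → Fin n → Bool
    sym   : ∀ u v → adj u v ≡ adj v u
    irrefl : ∀ u → adj u u ≡ false
open FinGraph public

toGraph : FinGraph → Graph
toGraph G = record { V = Fin (n G) ; E = λ u v → adj G u v ≡ true }

Edge : FinGraph → Set
Edge G = Σ (Fin (n G)) λ u → Σ (Fin (n G)) λ v → (u Fin.< v) × (adj G u v ≡ true)

tail head : (G : FinGraph) → Edge G → Fin (n G)
tail G (u , _) = u
head G (_ , v , _) = v

-- Vertices of S_t(G): original vertices, plus for every edge uv (u<v)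
-- t-1 inner vertices x_1,…,x_{t-1} (inner e i is x_{i+1}) on the path
-- u = x_0, x_1, …, x_t = v.
data SV (G : FinGraph) (t : ℕ) : Set where
  orig  : Fin (n G) → SV G t
  inner : Edge G → Fin (t ∸ 1) → SV G t

data Step (G : FinGraph) (t : ℕ) : SV G t → SV G t → Set where
  direct : (e : Edge G) → t ≡ 1 → Step G t (orig (tail G e)) (orig (head G e))
  first  : (e : Edge G) (i : Fin (t ∸ 1)) → toℕ i ≡ 0 →
           Step G t (orig (tail G e)) (inner e i)
  middle : (e : Edge G) (i j : Fin (t ∸ 1)) → suc (toℕ i) ≡ toℕ j →
           Step G t (inner e i) (inner e j)
  last   : (e : Edge G) (i : Fin (t ∸ 1)) → suc (toℕ i) ≡ t ∸ 1 →
           Step G t (inner e i) (orig (head G e))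

S : ℕ → FinGraph → Graph
S t G = record { V = SV G t ; E = λ x y → Step G t x y ⊎ Step G t y x }

frac : FinGraph → ℕ → ℕ → Graph
frac G r s = S (suc (2 * s)) G ^^ suc (2 * r)

Bipartite : FinGraph → Set
Bipartite G = Σ (Fin (n G) → Bool) λ c →
  ∀ u v → adj G u v ≡ true → c u ≢ c v

record Cycle (G : FinGraph) (ℓ : ℕ) : Set where
  field
    m      : ℕ
    len    : ℓ ≡ suc m
    len≥3  : 3 ≤ ℓ
    c      : Fin (suc m) → Fin (n G)
    inj    : Injective _≡_ _≡_ c
    step   : ∀ (i : Fin m) → adj G (c (inject₁ i)) (c (Fin.suc i)) ≡ true
    close  : adj G (c (fromℕ m)) (c Fin.zero) ≡ true

Odd : ℕ → Set
Odd ℓ = ∃ λ k → ℓ ≡ suc (2 * k)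

IsOddGirth : FinGraph → ℕ → Set
IsOddGirth G g = Odd g × Cycle G g × (∀ ℓ → Odd ℓ → Cycle G ℓ → g ≤ ℓ)

-- The rational (2r+1)/(2s+1) and the integer g as unnormalised rationals
-- (mkℚᵘ a b denotes a / (b+1)).
oddFrac : ℕ → ℕ → ℚᵘ
oddFrac r s = mkℚᵘ (+ suc (2 * r)) (2 * s)

ℕtoℚᵘ : ℕ → ℚᵘ
ℕtoℚᵘ g = mkℚᵘ (+ g) 0

{-# OPTIONS --safe #-}

-- Write α = a/b and γ = c/d for the two exponents.  A vertex of S_b(G) at distance i from
-- an end of its edge is sent to the position j ≡ i (mod 2) of the same edge in S_d(G) with
-- |bj - di| < b.  A walk of length ℓ becomes one of length ℓ′ ≡ ℓ (mod 2) with
-- bℓ′ < dℓ + 2b, so by parity this is a homomorphism G^α ⟶ G^γ whenever α ≤ γ.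
--
-- Conversely, with X = S_bd(G) and M = ad, a homomorphism G^γ ⟶ G^α yields
-- f : X^(M+2) ⟶ X^M.  Choose f with smallest image A.  Then every homomorphism A ⟶ A of
-- graphs induced by X^M is a bijection, so changing f|A at a single vertex never gives
-- another homomorphism.  Hence f cannot change when an argument a ∈ A slides along an even
-- walk: each M-neighbour b of a can slide towards a simultaneously (and keep its image),
-- with the two additional steps as slack.  As X has an odd closed walk, some a ∈ A is joined
-- to an M-neighbour by an even walk, so X^M has a loop; but M < bd · og(G) forbids loops.
module Submission where

open import Defs
open import Data.Nat as ℕ using (ℕ; zero; suc; _+_; _*_; _∸_; _≤_; s≤s; s≤s⁻¹; z≤n; z<s; s<s; parity; _/_; _%_; _<?_)
open import Data.Nat.Properties
open import Data.Nat.DivMod using (m≡m%n+[m/n]*n; m%n<n)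
open import Data.Nat.Induction using (<-rec)
open import Data.Nat.Tactic.RingSolver using (solve-∀)
open import Data.Parity.Base as ℙ using (0ℙ; 1ℙ)
import Data.Parity.Properties as ℙ
import Data.Integer as ℤ
open import Data.Integer.Properties using (drop‿+<+; pos-*)
open import Data.Rational.Unnormalised using (_<_)
open import Data.Rational.Unnormalised.Properties using (drop-*<*)
open import Data.Fin as Fin using (Fin; zero; suc; toℕ; fromℕ; fromℕ<; inject₁; punchIn; punchOut)
import Data.Fin.Properties as Fin
open import Data.Bool as Bool using (true)
open import Data.List using (List; []; [_]; map; allFin; concatMap; length) renaming (_++_ to _++ˡ_)
import Data.List as List
open import Data.List.Membership.Propositional using (_∈_; lose)
open import Data.List.Membership.Propositional.Properties using (∈-allFin; ∈-map⁺; ∈-concatMap⁺; ∈-++⁺ˡ; ∈-++⁺ʳ)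
open import Data.List.Relation.Unary.Any as Any using (here)
import Data.List.Relation.Unary.Any.Properties as Any
open import Data.Product using (∃; ∃₂; _×_; _,_; proj₁; proj₂)
open import Data.Sum using (_⊎_; inj₁; inj₂; swap)
open import Data.Empty using (⊥-elim)
open import Axiom.UniquenessOfIdentityProofs using (module Decidable⇒UIP)
open import Function using (_∘_)
open import Function.Definitions using (Injective)
open import Relation.Binary.Definitions using (Symmetric; tri<; tri≈; tri>)
open import Relation.Binary.PropositionalEquality as ≡ using (_≡_; _≢_; refl; cong; cong₂; subst; trans)
open import Relation.Nullary using (¬_; Dec; yes; no; contradiction; _×-dec_)

-- Operations on walks.

module _ {X : Graph} where

  recount : ∀ {k l x y} → k ≡ l → Walk X k x y → Walk X l x y
  recount eq = subst (λ k → Walk X k _ _) eq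

  infixr 5 _++_
  _++_ : ∀ {k l x y z} → Walk X k x y → Walk X l y z → Walk X (k + l) x z
  nil      ++ w = w
  cons e v ++ w = cons e (v ++ w)

  split : ∀ k {l x z} → Walk X (k + l) x z → ∃ λ y → Walk X k x y × Walk X l y z
  split zero    w          = _ , nil , w
  split (suc k) (cons e w) with y , u , v ← split k w = y , cons e u , v

  reverse : Symmetric (E X) → ∀ {k x y} → Walk X k x y → Walk X k y x
  reverse sym nil                = nil
  reverse sym (cons {k} e w) =
    recount (+-comm k 1) (reverse sym w ++ cons (sym e) nil)

  detour : Symmetric (E X) → ∀ {k x y} → Walk X (suc k) x y → Walk X (3 + k) x y
  detour sym (cons e w) = cons e (cons (sym e) (cons e w))

  repeat : ∀ k {l x} → Walk X l x x → Walk X (k * l) x x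
  repeat zero    w = nil
  repeat (suc k) w = w ++ repeat k w

  group : ∀ l {k x y} → Walk X (l * k) x y → Walk (X ^^ k) l x y
  group zero        nil = nil
  group (suc l) {k} w with _ , u , v ← split k w = cons u (group l v)

  ungroup : ∀ {l k x y} → Walk (X ^^ k) l x y → Walk X (l * k) x y
  ungroup nil        = nil
  ungroup (cons u w) = u ++ ungroup w

mapWalk : ∀ {X Y} (f : X ⟶ Y) {k x y} → Walk X k x y → Walk Y k (proj₁ f x) (proj₁ f y)
mapWalk f nil        = nil
mapWalk f (cons e w) = cons (proj₂ f e) (mapWalk f w)

-- Injections of finite sets, and finite enumerations.

injective⇒surjective : ∀ {n} {f : Fin n → Fin n} → Injective _≡_ _≡_ f → ∀ y → ∃ λ x → f x ≡ y
injective⇒surjective {suc n} {f} inj y with Fin.any? (λ x → f x Fin.≟ y)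
... | yes hit = hit
-- If `y` were missed, punching it out would inject `Fin (suc n)` into `Fin n`.
... | no miss = contradiction (Fin.injective⇒≤ {f = λ x → punchOut (y≢f x)} inj′) 1+n≰n
  where
  y≢f : ∀ x → y ≢ f x
  y≢f x eq = miss (x , ≡.sym eq)
  inj′ : Injective _≡_ _≡_ (λ x → punchOut (y≢f x))
  inj′ eq = inj (Fin.punchOut-injective (y≢f _) (y≢f _) eq)

-- `g i` is a value of `f`, say at `j`. If `j ≢ i`, then `g` also takes it at `j`, against
-- injectivity.
injective-agree : ∀ {n} {f g : Fin n → Fin n} → Injective _≡_ _≡_ f → Injective _≡_ _≡_ g →
                  ∀ i → (∀ j → j ≢ i → g j ≡ f j) → g i ≡ f i
injective-agree {g = g} f-inj g-inj i agree
  with j , fj≡gi ← injective⇒surjective f-inj (g i)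
  with j Fin.≟ i
... | yes refl = ≡.sym fj≡gi
... | no j≢i   = contradiction (g-inj (trans (agree j j≢i) fj≡gi)) j≢i

-- Repetitions in `lookup` are allowed, so any list containing every element will do.
record Enumeration (A : Set) : Set where
  field
    size   : ℕ
    index  : A → Fin size
    lookup : Fin size → A
    lookup-index : ∀ x → lookup (index x) ≡ x

-- Nonexistence of homomorphisms X^(M+2) ⟶ X^M

module _ {X : Graph} (sym : Symmetric (E X)) {M : ℕ} (loopless : ∀ x → ¬ Walk X M x x) where

  -- A homomorphism X^(M+2) ⟶ X^M with at most k values.
  record Factored (k : ℕ) : Set where
    field
      code   : V X → Fin k
      decode : Fin k → V X
      hom    : ∀ {x y} → Walk X (2 + M) x y → Walk X M (decode (code x)) (decode (code y))

  extend : ∀ {x y} → Walk X M x y → Walk X (2 + M) x y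
  extend = go loopless
    where
    go : ∀ {k} → (∀ x → ¬ Walk X k x x) → ∀ {x y} → Walk X k x y → Walk X (2 + k) x y
    -- Length zero cannot occur, since the empty walk would be a loop; any other walk has a first
    -- edge to retrace.
    go {zero}  noLoop {x} nil = ⊥-elim (noLoop x nil)
    go {suc k} noLoop w   = detour sym w

  module _ {k} (F : Factored (suc k)) where
    open Factored F

    -- The endomorphisms of the graph that `decode` pulls back from `X ^^ M` to the indices.
    Preserving : (Fin (suc k) → Fin (suc k)) → Set
    Preserving g = ∀ i j → Walk X M (decode i) (decode j) → Walk X M (decode (g i)) (decode (g j))

    -- Composing with `g` keeps the map a homomorphism, and since `g i ≡ g j`, the index `i` can
    -- stand in for `j`. This saves one value, so under minimality every such `g` is injective.
    merge : ∀ {g} → Preserving g → ∀ {i j} → j ≢ i → g i ≡ g j → Factored k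
    merge {g} pres {i} {j} j≢i gi≡gj = record
      { code = λ x → punchOut (avoid-≢ (code x))
      ; decode = λ l → decode (g (punchIn j l))
      ; hom = λ {x} {y} w → ≡.subst₂ (λ a b → Walk X M (decode a) (decode b))
                (undo (code x)) (undo (code y)) (pres _ _ (hom w))
      }
      where
      avoid : ∀ l → ∃ λ l′ → j ≢ l′ × g l′ ≡ g l
      avoid l with j Fin.≟ l
      ... | yes refl = i , j≢i , gi≡gj
      ... | no j≢l   = l , j≢l , refl
      avoid-≢ : ∀ l → j ≢ proj₁ (avoid l)
      avoid-≢ l = proj₁ (proj₂ (avoid l))
      undo : ∀ l → g l ≡ g (punchIn j (punchOut (avoid-≢ l)))
      undo l = ≡.sym (trans (cong g (Fin.punchIn-punchOut (avoid-≢ l))) (proj₂ (proj₂ (avoid l))))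

    module _ (minimal : ¬ Factored k) where

      preserving⇒injective : ∀ {g} → Preserving g → Injective _≡_ _≡_ g
      preserving⇒injective pres {i} {j} gi≡gj with j Fin.≟ i
      ... | yes j≡i = ≡.sym j≡i
      ... | no  j≢i = contradiction (merge pres j≢i gi≡gj) minimal

      self : Fin (suc k) → Fin (suc k)
      self i = code (decode i)

      self-preserving : Preserving self
      self-preserving i j w = hom (extend w)

      -- Redirecting the single vertex i to code z keeps the map a homomorphism: a walk
      -- of length M from decode j to decode i, prolonged to z, can be cut 2t steps after
      -- its start at a point that, by induction, has the same code as decode j.
      code-constant : ∀ t {i z} → Walk X (t * 2) (decode i) z → code z ≡ code (decode i)
      code-constant zero            nil = refl
      -- `self` and `g` are both injective and agree away from `i`, hence also at `i`.
      code-constant (suc t) {i} {z} w = trans (≡.sym g-i) (injective-agree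
          (preserving⇒injective self-preserving) (preserving⇒injective g-preserving) i g-≢)
        where
        g : Fin (suc k) → Fin (suc k)
        g j with j Fin.≟ i
        ... | yes _ = code z
        ... | no  _ = self j
        g-i : g i ≡ code z
        g-i with i Fin.≟ i
        ... | yes _  = refl
        ... | no i≢i = contradiction refl i≢i
        g-≢ : ∀ j → j ≢ i → g j ≡ self j
        g-≢ j j≢i with j Fin.≟ i
        ... | yes j≡i = contradiction j≡i j≢i
        ... | no _    = refl
        lengths : ∀ m t → m + (2 + t) ≡ t + (2 + m)
        lengths = solve-∀
        toward : ∀ j → Walk X M (decode j) (decode i) → Walk X M (decode (self j)) (decode (code z))
        toward j v with _ , u , u′ ← split (t * 2) (recount (lengths M (t * 2)) (v ++ w)) =
          subst (λ l → Walk X M (decode l) (decode (code z))) (code-constant t u) (hom u′)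
        g-preserving : Preserving g
        g-preserving a b v with a Fin.≟ i | b Fin.≟ i
        ... | yes refl | yes refl = contradiction v (loopless _)
        ... | yes refl | no _     = reverse sym (toward b (reverse sym v))
        ... | no _     | yes refl = toward a v
        ... | no _     | no _     = self-preserving a b v

  -- Induction on `k` supplies the minimality. Repeating `w` `2 + M` times and cutting into blocks
  -- of length `2 + M` gives an odd closed walk of `X ^^ (2 + M)`. All its edges but the first map
  -- to an even walk of `X`, so `code-constant` identifies the values at the ends of the first edge,
  -- whose image is then a loop.
  ¬Factored : ∀ {v} h → Walk X (suc (h * 2)) v v → ∀ k → ¬ Factored k
  ¬Factored {v} h w zero    F = contradiction (Factored.code F v) Fin.¬Fin0
  ¬Factored {v} h w (suc k) F
    with group (suc (h * 2)) (recount (*-comm (2 + M) (suc (h * 2))) (repeat (2 + M) w))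
  ... | cons {y = u} vu uv = loopless _ (subst (λ l → Walk X M (decode l) (decode (self′ u)))
                                         same (hom (extend (hom vu))))
    where
    open Factored F
    self′ : V X → Fin (suc k)
    self′ x = code (decode (code x))
    lengths : ∀ a b → a * 2 * b ≡ a * b * 2
    lengths = solve-∀
    same : self′ v ≡ self′ u
    same = code-constant F (¬Factored h w k) (h * M)
             (recount (lengths h M) (ungroup (mapWalk (decode ∘ code , hom) uv)))

  no-shrinking : Enumeration (V X) → ∀ {v} h → Walk X (suc (h * 2)) v v →
                 ¬ ((X ^^ (2 + M)) ⟶ (X ^^ M))
  no-shrinking enum h w (f , f-hom) = ¬Factored h w size (record
    { code   = index ∘ f
    ; decode = lookup
    ; hom    = λ {x} {y} v → ≡.subst₂ (Walk X M) (≡.sym (lookup-index (f x)))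
                               (≡.sym (lookup-index (f y))) (f-hom v)
    })
    where open Enumeration enum

-- Odd closed walks and odd cycles

module _ {X : Graph} where

  -- The final vertex is left out, so for a closed walk injectivity of `at w` means that no vertex
  -- is visited twice.
  at : ∀ {k x y} → Walk X k x y → Fin k → V X
  at (cons {x = x} _ _) zero    = x
  at (cons _ w)         (suc i) = at w i

  at-zero : ∀ {k x y} (w : Walk X (suc k) x y) → at w zero ≡ x
  at-zero (cons _ _) = refl

  at-step : ∀ {k x y} (w : Walk X (suc k) x y) i → E X (at w (inject₁ i)) (at w (suc i))
  at-step (cons e (cons _ _)) zero    = e
  at-step (cons _ w@(cons _ _)) (suc i) = at-step w i

  at-last : ∀ {k x y} (w : Walk X (suc k) x y) → E X (at w (fromℕ k)) y
  at-last (cons e nil)            = e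
  at-last (cons _ w@(cons _ _)) = at-last w

  cut : ∀ {k x y} (w : Walk X k x y) i →
        ∃ λ l → Walk X (toℕ i) x (at w i) × Walk X (suc l) (at w i) y × toℕ i + suc l ≡ k
  cut (cons e w) zero    = _ , nil , cons e w , refl
  cut (cons e w) (suc i) with l , u , v , eq ← cut w i = l , cons e u , v , cong suc eq

  -- The last two pieces are visibly nonempty, so for a repeated vertex both removing the middle
  -- piece and keeping only it give shorter closed walks.
  cut₂ : ∀ {k x y} (w : Walk X k x y) i j → i Fin.< j → ∃₂ λ m l →
         Walk X (toℕ i) x (at w i) × Walk X (suc m) (at w i) (at w j) ×
         Walk X (suc l) (at w j) y × toℕ i + (suc m + suc l) ≡ k
  cut₂ (cons e w) zero (suc j) z<s with l , u , v , eq ← cut w j =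
    _ , l , nil , cons e u , v , cong suc eq
  cut₂ (cons e w) (suc i) (suc j) (s<s i<j) with m , l , u , v , t , eq ← cut₂ w i j i<j =
    m , l , cons e u , v , t , cong suc eq

parity-1⇒Odd : ∀ n → parity n ≡ 1ℙ → Odd n
parity-1⇒Odd 1             _  = 0 , refl
parity-1⇒Odd (suc (suc n)) eq with k , refl ← parity-1⇒Odd n eq =
  suc k , cong (2 +_) (≡.sym (+-suc k (k + 0)))

+-odd : ∀ m n → parity (m + n) ≡ 1ℙ → parity m ≡ 1ℙ ⊎ parity n ≡ 1ℙ
+-odd m n eq with parity m | parity n | ℙ.+-homo-+ m n
... | 1ℙ | _  | _  = inj₁ refl
... | 0ℙ | 1ℙ | _  = inj₂ refl
... | 0ℙ | 0ℙ | eq′ = contradiction (trans (≡.sym eq) eq′) λ ()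

module _ (G : FinGraph) where

  private X = toGraph G

  OddCycle≤ : ℕ → Set
  OddCycle≤ k = ∃ λ ℓ → ℓ ≤ k × Odd ℓ × Cycle G ℓ

  repetition? : ∀ {k x y} (w : Walk X k x y) →
                Dec (∃₂ λ i j → i Fin.< j × at w i ≡ at w j)
  repetition? w = Fin.any? λ i → Fin.any? λ j → i Fin.<? j ×-dec at w i Fin.≟ at w j

  no-repetition⇒injective : ∀ {k x y} (w : Walk X k x y) →
    ¬ (∃₂ λ i j → i Fin.< j × at w i ≡ at w j) → Injective _≡_ _≡_ (at w)
  no-repetition⇒injective w none {i} {j} eq with Fin.<-cmp i j
  ... | tri< i<j _ _ = contradiction (i , j , i<j , eq) none
  ... | tri≈ _ i≡j _ = i≡j
  ... | tri> _ _ j<i = contradiction (j , i , j<i , ≡.sym eq) none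

  -- Strong induction on the length. A repeated vertex splits the walk into two shorter closed
  -- walks, one of them odd; without repetition the walk is itself a cycle.
  oddClosedWalk⇒oddCycle : ∀ k → parity k ≡ 1ℙ → ∀ {x} → Walk X k x x → OddCycle≤ k
  oddClosedWalk⇒oddCycle = <-rec _ go
    where
    go : ∀ k → (∀ {l} → l ℕ.< k → parity l ≡ 1ℙ → ∀ {x} → Walk X l x x → OddCycle≤ l) →
         parity k ≡ 1ℙ → ∀ {x} → Walk X k x x → OddCycle≤ k
    -- `irrefl` rules out length one and parity rules out zero and two, leaving the length at least
    -- three that `Cycle` demands.
    go 1 _ _ {x} (cons e nil) = contradiction (trans (≡.sym (irrefl G x)) e) λ ()
    go k@(suc k′@(suc (suc _))) rec odd {x} w with repetition? w
    ... | no none = k , ≤-refl , parity-1⇒Odd k odd , record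
      { m     = k′
      ; len   = refl
      ; len≥3 = s≤s (s≤s (s≤s z≤n))
      ; c     = at w
      ; inj   = no-repetition⇒injective w none
      ; step  = at-step w
      ; close = subst (E X (at w (fromℕ k′))) (≡.sym (at-zero w)) (at-last w)
      }
    ... | yes (i , j , i<j , eq) with m , l , u , v , t , lengths ← cut₂ w i j i<j =
      conclude (+-odd (suc m) (toℕ i + suc l) (trans (cong parity inner+outer) odd))
      where
      exchange : ∀ a b c → b + (a + c) ≡ a + (b + c)
      exchange = solve-∀
      inner+outer : suc m + (toℕ i + suc l) ≡ k
      inner+outer = trans (exchange (toℕ i) (suc m) (suc l)) lengths
      inner< : suc m ℕ.< k
      inner< = subst (suc m ℕ.<_) inner+outer
        (m<m+n (suc m) (≤-trans (s≤s z≤n) (m≤n+m (suc l) (toℕ i))))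
      outer< : toℕ i + suc l ℕ.< k
      outer< = subst (toℕ i + suc l ℕ.<_) inner+outer (s≤s (m≤n+m _ m))
      weaken : ∀ {n} → n ℕ.< k → OddCycle≤ n → OddCycle≤ k
      weaken n<k (ℓ , ℓ≤n , rest) = ℓ , ≤-trans ℓ≤n (<⇒≤ n<k) , rest
      conclude : parity (suc m) ≡ 1ℙ ⊎ parity (toℕ i + suc l) ≡ 1ℙ → OddCycle≤ k
      conclude (inj₁ o) = weaken inner< (rec inner< o (subst (Walk X _ (at w i)) (≡.sym eq) v))
      conclude (inj₂ o) = weaken outer< (rec outer< o (u ++ subst (λ z → Walk X _ z x) (≡.sym eq) t))

  oddGirth≤ : ∀ {g} → IsOddGirth G g → ∀ {k x} → parity k ≡ 1ℙ → Walk X k x x → g ≤ k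
  oddGirth≤ (_ , _ , least) odd w
    with ℓ , ℓ≤k , ℓ-odd , cyc ← oddClosedWalk⇒oddCycle _ odd w = ≤-trans (least ℓ ℓ-odd cyc) ℓ≤k

  path : ∀ {m} (c : Fin (suc m) → Fin (n G)) →
         (∀ (i : Fin m) → adj G (c (inject₁ i)) (c (suc i)) ≡ true) →
         Walk X m (c zero) (c (fromℕ m))
  path {zero}  c step = nil
  path {suc m} c step = cons (step zero) (path (c ∘ suc) (step ∘ suc))

  cycle⇒closedWalk : ∀ {ℓ} → Cycle G ℓ → ∃ λ x → Walk X ℓ x x
  cycle⇒closedWalk cyc = c zero ,
    recount (trans (+-comm m 1) (≡.sym len)) (path c step ++ cons close nil)
    where open Cycle cyc

  -- Enumerating the vertices of a subdivision

  edgesFrom : Fin (n G) → Fin (n G) → List (Edge G)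
  edgesFrom u v with u Fin.<? v | adj G u v Bool.≟ true
  ... | yes u<v | yes uv = [ u , v , u<v , uv ]
  ... | _       | _      = []

  ∈-edgesFrom : (e : Edge G) → e ∈ edgesFrom (tail G e) (head G e)
  ∈-edgesFrom (u , v , u<v , uv) with u Fin.<? v | adj G u v Bool.≟ true
  ... | no ¬u<v  | _      = contradiction u<v ¬u<v
  ... | yes u<v′ | no ¬uv = contradiction uv ¬uv
  ... | yes u<v′ | yes uv′ =
    -- The edge found carries its own proofs of `u < v` and of adjacency; both kinds of proof are
    -- unique.
    here (cong₂ (λ a b → u , v , a , b) (Fin.<-irrelevant u<v u<v′)
      (Decidable⇒UIP.≡-irrelevant Bool._≟_ uv uv′))

  edges : List (Edge G)
  edges = concatMap (λ u → concatMap (edgesFrom u) (allFin _)) (allFin _)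

  ∈-edges : ∀ e → e ∈ edges
  ∈-edges e = ∈-concatMap⁺ _ (lose (∈-allFin (tail G e))
                (∈-concatMap⁺ _ (lose (∈-allFin (head G e)) (∈-edgesFrom e))))

  subdivisionVertices : ∀ t → List (SV G t)
  subdivisionVertices t = map orig (allFin _) ++ˡ concatMap (λ e → map (inner e) (allFin _)) edges

  ∈-subdivisionVertices : ∀ {t} (x : SV G t) → x ∈ subdivisionVertices t
  ∈-subdivisionVertices (orig u)    = ∈-++⁺ˡ (∈-map⁺ orig (∈-allFin u))
  ∈-subdivisionVertices (inner e i) =
    ∈-++⁺ʳ _ (∈-concatMap⁺ _ (lose (∈-edges e) (∈-map⁺ (inner e) (∈-allFin i))))

  enumerate : ∀ t → Enumeration (SV G t)
  enumerate t = record
    { size         = length (subdivisionVertices t)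
    ; index        = λ x → Any.index (∈-subdivisionVertices x)
    ; lookup       = List.lookup (subdivisionVertices t)
    ; lookup-index = λ x → ≡.sym (Any.lookup-index (∈-subdivisionVertices x))
    }

-- Parity arithmetic and walks of odd length.

parity-suc : ∀ n → parity (suc n) ≡ parity n ℙ.⁻¹
parity-suc n = ℙ.+-homo-+ 1 n

≢⇒⁻¹≡ : ∀ {p q} → p ≢ q → p ℙ.⁻¹ ≡ q
≢⇒⁻¹≡ {0ℙ} {0ℙ} p≢q = contradiction refl p≢q
≢⇒⁻¹≡ {0ℙ} {1ℙ} _   = refl
≢⇒⁻¹≡ {1ℙ} {0ℙ} _   = refl
≢⇒⁻¹≡ {1ℙ} {1ℙ} p≢q = contradiction refl p≢q

parity-cong-suc : ∀ m n → parity m ≡ parity n → parity (suc m) ≡ parity (suc n)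
parity-cong-suc m n eq = trans (parity-suc m) (trans (cong ℙ._⁻¹ eq) (≡.sym (parity-suc n)))

parity-cong-+ : ∀ m m′ {n n′} → parity m ≡ parity m′ → parity n ≡ parity n′ →
                parity (m + n) ≡ parity (m′ + n′)
parity-cong-+ m m′ {n} {n′} eq eq′ =
  trans (ℙ.+-homo-+ m n) (trans (cong₂ ℙ._+_ eq eq′) (≡.sym (ℙ.+-homo-+ m′ n′)))

parity-cancel-+ : ∀ m m′ {n n′} → parity m ≡ parity m′ → parity (m + n) ≡ parity (m′ + n′) →
                  parity n ≡ parity n′
parity-cancel-+ m m′ {n} {n′} eq eq′ = ℙ.+-cancelˡ-≡ (parity m) _ _ (begin
  parity m ℙ.+ parity n   ≡⟨ ℙ.+-homo-+ m n ⟨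
  parity (m + n)          ≡⟨ eq′ ⟩
  parity (m′ + n′)        ≡⟨ ℙ.+-homo-+ m′ n′ ⟩
  parity m′ ℙ.+ parity n′ ≡⟨ cong (ℙ._+ parity n′) eq ⟨
  parity m ℙ.+ parity n′  ∎)
  where open ≡.≡-Reasoning

parity-double : ∀ n → parity (n + n) ≡ 0ℙ
parity-double n = trans (ℙ.+-homo-+ n n) (ℙ.p+p≡0ℙ (parity n))

parity-*-odd : ∀ m n → parity n ≡ 1ℙ → parity (m * n) ≡ parity m
parity-*-odd m n odd = trans (ℙ.*-homo-* m n) (trans (cong (parity m ℙ.*_) odd) (ℙ.*-identityʳ (parity m)))

parity-odd : ∀ n → parity (suc (2 * n)) ≡ 1ℙ
parity-odd n = trans (parity-suc (2 * n)) (cong ℙ._⁻¹ (ℙ.*-homo-* 2 n))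

-- Only `m ≡ suc n` has to be excluded, and parity does so. This is how a rounding error below two
-- is absorbed.
parity≡⇒≤ : ∀ {m n} → parity m ≡ parity n → m ℕ.< 2 + n → m ≤ n
parity≡⇒≤ {zero}        {n}           eq _  = z≤n
parity≡⇒≤ {suc zero}    {zero}        () _
parity≡⇒≤ {suc zero}    {suc n}       eq _  = s≤s z≤n
parity≡⇒≤ {suc (suc m)} {zero}        eq (s≤s (s≤s ()))
parity≡⇒≤ {suc (suc m)} {suc zero}    eq (s≤s (s≤s (s≤s z≤n))) = contradiction eq λ ()
parity≡⇒≤ {suc (suc m)} {suc (suc n)} eq (s≤s (s≤s lt)) = s≤s (s≤s (parity≡⇒≤ eq lt))

-- The even difference is spent going back and forth on the last edge, which exists because `k` is
-- odd.
lengthen : ∀ {X} → Symmetric (E X) → ∀ {k l x y} → parity k ≡ 1ℙ → parity l ≡ 1ℙ → k ≤ l →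
           Walk X k x y → Walk X l x y
lengthen sym {suc zero}    {suc zero}    _ _ _ w = w
lengthen sym {suc zero}    {suc (suc (suc l))} _ odd _ w =
  detour sym (lengthen sym {1} {suc l} refl odd (s≤s z≤n) w)
lengthen sym {suc (suc k)} {suc (suc l)} k-odd l-odd (s≤s (s≤s k≤l)) (cons e (cons e′ w)) =
  cons e (cons e′ (lengthen sym k-odd l-odd k≤l w))

-- Walks in a subdivision

adj-sym : ∀ (G : FinGraph) {u v} → adj G u v ≡ true → adj G v u ≡ true
adj-sym G {u} {v} uv = trans (FinGraph.sym G v u) uv

S-sym : ∀ {t G} → Symmetric (E (S t G))
S-sym = swap

module Subdivision (G : FinGraph) (k : ℕ) where

  X : Graph
  X = S (suc k) G

  -- The segment from a vertex to the end `w` of its edge has `α` steps. `inner e i` sits at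
  -- position `suc (toℕ i)`, and the head at `suc k`.
  data End : V X → Fin (n G) → ℕ → Set where
    stop   : ∀ {u} → End (orig u) u 0
    toTail : ∀ {e i α} → α ≡ suc (toℕ i) → End (inner e i) (tail G e) α
    toHead : ∀ {e i α} → suc (toℕ i) + α ≡ suc k → End (inner e i) (head G e) α

  -- A normal form for walks: go to an end of the edge, cross `m` whole edges of `G`, and enter the
  -- edge of the target; or stay inside one edge.
  data Route : V X → V X → ℕ → Set where
    through : ∀ {x y w w′ α m β ℓ} → End x w α → Walk (toGraph G) m w w′ → End y w′ β →
              ℓ ≡ α + m * suc k + β → Route x y ℓ
    along   : ∀ {e i j ℓ} → toℕ i + ℓ ≡ toℕ j ⊎ toℕ j + ℓ ≡ toℕ i → Route (inner e i) (inner e j) ℓ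

  -- The effect on a segment of prepending a step from a new vertex `x`, where `α` is the old
  -- length. In `across` the step completes a whole edge, with `x` at its other end.
  data StepEnd (x : V X) (w : Fin (n G)) (α : ℕ) : Set where
    away   : End x w (suc α) → StepEnd x w α
    closer : ∀ {α′} → α ≡ suc α′ → End x w α′ → StepEnd x w α
    across : ∀ {u} → x ≡ orig u → α ≡ k → adj G u w ≡ true → StepEnd x w α

  stepEnd : ∀ {x′ x w α} → E X x′ x → End x w α → StepEnd x′ w α
  stepEnd (inj₁ (direct (u , v , _ , uv) 1+k≡1)) stop = across refl (≡.sym (suc-injective 1+k≡1)) uv
  stepEnd (inj₁ (first e i i≡0)) (toTail α≡) = closer (trans α≡ (cong suc i≡0)) stop
  stepEnd (inj₁ (first e@(u , v , _ , uv) i i≡0)) (toHead {α = α} eq) =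
    across refl (suc-injective (trans (cong (λ i → suc i + α) (≡.sym i≡0)) eq)) uv
  stepEnd (inj₁ (middle e i j 1+i≡j)) (toTail α≡) = closer α≡ (toTail (≡.sym 1+i≡j))
  stepEnd (inj₁ (middle e i j 1+i≡j)) (toHead {α = α} eq) =
    away (toHead (trans (+-suc (suc (toℕ i)) α) (trans (cong (λ j → suc j + α) 1+i≡j) eq)))
  stepEnd (inj₁ (last e i 1+i≡k)) stop = away (toHead (trans (+-comm (suc (toℕ i)) 1) (cong suc 1+i≡k)))
  stepEnd (inj₂ (direct (u , v , _ , uv) 1+k≡1)) stop =
    across refl (≡.sym (suc-injective 1+k≡1)) (adj-sym G uv)
  stepEnd (inj₂ (first e i i≡0)) stop = away (toTail (cong suc (≡.sym i≡0)))
  stepEnd (inj₂ (middle e i j 1+i≡j)) (toTail α≡) = away (toTail (cong suc (trans α≡ 1+i≡j)))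
  stepEnd (inj₂ (middle e i j 1+i≡j)) (toHead {α = zero} eq) =
    contradiction (Fin.toℕ<n j) (<-asym
      (subst (k ℕ.<_) (trans (≡.sym eq) (trans (+-identityʳ _) 1+i≡j)) (n<1+n k)))
  stepEnd (inj₂ (middle e i j 1+i≡j)) (toHead {α = suc α} eq) =
    closer refl (toHead (trans (cong (λ j → suc j + α) (≡.sym 1+i≡j))
      (trans (≡.sym (+-suc (suc (toℕ i)) α)) eq)))
  stepEnd (inj₂ (last e@(u , v , _ , uv) i 1+i≡k)) (toTail α≡) =
    across refl (trans α≡ 1+i≡k) (adj-sym G uv)
  stepEnd (inj₂ (last e i 1+i≡k)) (toHead {α = α} eq) =
    closer (+-cancelˡ-≡ k _ _ (trans (cong (_+ α) (≡.sym 1+i≡k)) (trans eq (+-comm 1 k)))) stop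

  private
    m+n≡m⇒n≡0 : ∀ {m n} → m + n ≡ m → n ≡ 0
    m+n≡m⇒n≡0 {m} eq = +-cancelˡ-≡ m _ _ (trans eq (≡.sym (+-identityʳ m)))

  Adjusted : V X → V X → ℕ → Set
  Adjusted x y ℓ = ∃ λ ℓ′ → Route x y ℓ′ × (ℓ′ ≡ suc ℓ ⊎ suc ℓ′ ≡ ℓ)

  -- A step either extends the route or cancels against its beginning. The length changes by exactly
  -- one, which preserves parity along a whole walk.
  stepRoute : ∀ {x′ x y ℓ} → E X x′ x → Route x y ℓ → Adjusted x′ y ℓ
  stepRoute step (through x→w w→w′ y→w′ refl) with stepEnd step x→w
  ... | away x′→w = _ , through x′→w w→w′ y→w′ refl , inj₁ refl
  ... | closer refl x′→w = _ , through x′→w w→w′ y→w′ refl , inj₂ refl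
  ... | across refl refl uw = _ , through stop (cons uw w→w′) y→w′ refl , inj₁ refl
  stepRoute (inj₁ (first e i i≡0)) (along {j = j} {ℓ} gap) =
    _ , through stop nil (toTail refl) refl , inj₁ (cong suc (j≡ℓ gap))
    where
    j≡ℓ : toℕ i + ℓ ≡ toℕ j ⊎ toℕ j + ℓ ≡ toℕ i → toℕ j ≡ ℓ
    j≡ℓ (inj₁ eq) = trans (≡.sym eq) (cong (_+ ℓ) i≡0)
    j≡ℓ (inj₂ eq) = trans (m+n≡0⇒m≡0 (toℕ j) (trans eq i≡0)) (≡.sym (m+n≡0⇒n≡0 (toℕ j) (trans eq i≡0)))
  stepRoute (inj₁ (middle e i′ i 1+i′≡i)) (along {ℓ = ℓ} (inj₁ eq)) =
    suc ℓ , along (inj₁ (trans (+-suc (toℕ i′) ℓ) (trans (cong (_+ ℓ) 1+i′≡i) eq))) , inj₁ refl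
  stepRoute (inj₁ (middle e i′ i 1+i′≡i)) (along {j = j} {ℓ = zero} (inj₂ eq)) =
    1 , along (inj₁ (trans (+-comm (toℕ i′) 1)
      (trans 1+i′≡i (trans (≡.sym eq) (+-identityʳ (toℕ j)))))) , inj₁ refl
  stepRoute (inj₁ (middle e i′ i 1+i′≡i)) (along {j = j} {ℓ = suc ℓ} (inj₂ eq)) =
    ℓ , along (inj₂ (suc-injective (trans (≡.sym (+-suc (toℕ j) ℓ)) (trans eq (≡.sym 1+i′≡i))))) , inj₂ refl
  stepRoute (inj₂ (middle e i i′ 1+i≡i′)) (along {ℓ = zero} (inj₁ eq)) =
    1 , along (inj₂ (trans (cong (_+ 1) (trans (≡.sym eq) (+-identityʳ (toℕ i))))
      (trans (+-comm (toℕ i) 1) 1+i≡i′))) , inj₁ refl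
  stepRoute (inj₂ (middle e i i′ 1+i≡i′)) (along {ℓ = suc ℓ} (inj₁ eq)) =
    ℓ , along (inj₁ (trans (cong (_+ ℓ) (≡.sym 1+i≡i′)) (trans (≡.sym (+-suc (toℕ i) ℓ)) eq))) , inj₂ refl
  stepRoute (inj₂ (middle e i i′ 1+i≡i′)) (along {j = j} {ℓ = ℓ} (inj₂ eq)) =
    suc ℓ , along (inj₂ (trans (+-suc (toℕ j) ℓ) (trans (cong suc eq) 1+i≡i′))) , inj₁ refl
  stepRoute (inj₂ (last e i 1+i≡k)) (along {j = j} {ℓ} gap) =
    suc ℓ , through stop nil (toHead (cong suc (trans (+-suc (toℕ j) ℓ)
      (trans (cong suc (j+ℓ≡i gap)) 1+i≡k)))) refl , inj₁ refl
    where
    j+ℓ≡i : toℕ i + ℓ ≡ toℕ j ⊎ toℕ j + ℓ ≡ toℕ i → toℕ j + ℓ ≡ toℕ i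
    j+ℓ≡i (inj₂ eq) = eq
    j+ℓ≡i (inj₁ eq) = trans (cong₂ _+_ (≤-antisym j≤i i≤j) ℓ≡0) (+-identityʳ (toℕ i))
      where
      j≤i : toℕ j ≤ toℕ i
      j≤i = s≤s⁻¹ (subst (toℕ j ℕ.<_) (≡.sym 1+i≡k) (Fin.toℕ<n j))
      i≤j : toℕ i ≤ toℕ j
      i≤j = subst (toℕ i ≤_) eq (m≤m+n (toℕ i) ℓ)
      ℓ≡0 : ℓ ≡ 0
      ℓ≡0 = m+n≡m⇒n≡0 (trans eq (≤-antisym j≤i i≤j))

  walk⇒route : ∀ {l x y} → Walk X l x y → ∃ λ ℓ → Route x y ℓ × ℓ ≤ l × parity ℓ ≡ parity l
  walk⇒route {x = orig u}    nil = 0 , through stop nil stop refl , z≤n , refl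
  walk⇒route {x = inner e i} nil = 0 , along (inj₁ (+-identityʳ (toℕ i))) , z≤n , refl
  walk⇒route (cons {l} step w) with ℓ , route , ℓ≤l , same ← walk⇒route w with stepRoute step route
  ... | _ , route′ , inj₁ refl = _ , route′ , s≤s ℓ≤l , parity-cong-suc ℓ l same
  ... | ℓ′ , route′ , inj₂ refl =
    ℓ′ , route′ , ≤-trans (n≤1+n ℓ′) (m≤n⇒m≤1+n ℓ≤l) , parity-cong-suc (suc ℓ′) l same

  module _ (odd : parity (suc k) ≡ 1ℙ) where

    -- Equal ends give `α ≡ β`, an even sum. Opposite ends give `α + β ≡ suc k`, an odd sum matching
    -- the single edge between them.
    ends-connected : ∀ {x w w′ α β} → End x w α → End x w′ β →
      ∃ λ m → Walk (toGraph G) m w′ w × m * suc k ≤ α + β × parity m ≡ parity (α + β)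
    ends-connected stop stop = 0 , nil , z≤n , refl
    ends-connected (toTail {i = i} refl) (toTail refl) = 0 , nil , z≤n , ≡.sym (parity-double (suc (toℕ i)))
    ends-connected {α = α} {β} (toHead {i = i} eq) (toHead eq′) = 0 , nil , z≤n ,
      ≡.sym (trans (cong (λ γ → parity (γ + β)) (+-cancelˡ-≡ (suc (toℕ i)) _ _ (trans eq (≡.sym eq′))))
                   (parity-double β))
    ends-connected {β = β} (toTail {u , v , _ , uv} refl) (toHead eq) =
      1 , cons (adj-sym G uv) nil , ≤-reflexive (trans (*-identityˡ (suc k)) (≡.sym eq)) ,
      ≡.sym (trans (cong parity eq) odd)
    ends-connected {α = α} (toHead {u , v , _ , uv} eq) (toTail refl) =
      1 , cons uv nil , ≤-reflexive (trans (*-identityˡ (suc k)) (≡.sym (trans (+-comm α _) eq))) ,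
      ≡.sym (trans (cong parity (trans (+-comm α _) eq)) odd)

    -- A closed route inside one edge has length zero, which is even. Otherwise `ends-connected`
    -- closes up its part in `G`, and as `suc k` is odd, multiplying by it keeps parity.
    closedWalk⇒closedWalk : ∀ {l x} → parity l ≡ 1ℙ → Walk X l x x →
      ∃₂ λ m w → Walk (toGraph G) m w w × parity m ≡ 1ℙ × m * suc k ≤ l
    closedWalk⇒closedWalk l-odd w with walk⇒route w
    ... | ℓ , along {i = i} gap , _ , same = contradiction
      (trans (≡.sym (trans same l-odd)) (cong parity {x = ℓ} (ℓ≡0 gap))) λ ()
      where
      ℓ≡0 : toℕ i + ℓ ≡ toℕ i ⊎ toℕ i + ℓ ≡ toℕ i → ℓ ≡ 0
      ℓ≡0 (inj₁ eq) = m+n≡m⇒n≡0 eq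
      ℓ≡0 (inj₂ eq) = m+n≡m⇒n≡0 eq
    ... | _ , through {w = a} {α = α} {m} {β} x→a a→b x→b refl , ℓ≤l , same
      with m′ , b→a , short , same′ ← ends-connected x→a x→b =
      m + m′ , a , a→b ++ b→a , m+m′-odd , bound
      where
      rearrange : ∀ α m k β → m * suc k + (α + β) ≡ α + m * suc k + β
      rearrange = solve-∀
      bound : (m + m′) * suc k ≤ _
      bound = ≤-trans (≤-reflexive (*-distribʳ-+ (suc k) m m′)) (≤-trans (+-monoʳ-≤ (m * suc k) short)
                (≤-trans (≤-reflexive (rearrange α m k β)) ℓ≤l))
      m+m′-odd : parity (m + m′) ≡ 1ℙ
      m+m′-odd = trans (parity-cong-+ m (m * suc k) (≡.sym (parity-*-odd m (suc k) odd)) same′)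
        (trans (cong parity (rearrange α m k β)) (trans same l-odd))

  -- Positions beyond `suc k` default to the head; walks are built only for positions up to `suc k`.
  point : Edge G → ℕ → V X
  point e zero    = orig (tail G e)
  point e (suc j) with j <? k
  ... | yes j<k = inner e (fromℕ< j<k)
  ... | no _    = orig (head G e)

  point-end : ∀ e → point e (suc k) ≡ orig (head G e)
  point-end e with k <? k
  ... | yes k<k = contradiction k<k (<-irrefl refl)
  ... | no _    = refl

  point-step : ∀ e j → j ℕ.< suc k → E X (point e j) (point e (suc j))
  point-step e zero _ with 0 <? k
  ... | yes 0<k = inj₁ (first e _ (Fin.toℕ-fromℕ< 0<k))
  ... | no 0≮k  = inj₁ (direct e (cong suc (n≤0⇒n≡0 (≮⇒≥ 0≮k))))
  point-step e (suc j) 1+j<1+k with j <? k | suc j <? k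
  ... | no j≮k  | _         = contradiction (s≤s⁻¹ 1+j<1+k) j≮k
  ... | yes j<k | yes 1+j<k = inj₁ (middle e _ _
    (trans (cong suc (Fin.toℕ-fromℕ< j<k)) (≡.sym (Fin.toℕ-fromℕ< 1+j<k))))
  ... | yes j<k | no 1+j≮k  = inj₁ (last e _
    (trans (cong suc (Fin.toℕ-fromℕ< j<k)) (≤-antisym j<k (≮⇒≥ 1+j≮k))))

  point-walk : ∀ e j l → j + l ≤ suc k → Walk X l (point e j) (point e (j + l))
  point-walk e j zero    _     = subst (Walk X 0 (point e j)) (cong (point e) (≡.sym (+-identityʳ j))) nil
  point-walk e j (suc l) bound =
    cons (point-step e j (≤-trans (s≤s (m≤m+n j l)) bound′))
         (subst (Walk X l (point e (suc j))) (cong (point e) (≡.sym (+-suc j l)))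
           (point-walk e (suc j) l bound′))
    where
    bound′ : suc (j + l) ≤ suc k
    bound′ = subst (_≤ suc k) (+-suc j l) bound

  edge-walk : ∀ {u v} → adj G u v ≡ true → Walk X (suc k) (orig u) (orig v)
  edge-walk {u} {v} uv with Fin.<-cmp u v
  ... | tri< u<v _ _ = subst (Walk X (suc k) (orig u)) (point-end e) (point-walk e 0 (suc k) ≤-refl)
    where e = u , v , u<v , uv
  ... | tri≈ _ refl _ = contradiction (trans (≡.sym (irrefl G u)) uv) λ ()
  ... | tri> _ _ v<u = reverse S-sym
    (subst (Walk X (suc k) (orig v)) (point-end e) (point-walk e 0 (suc k) ≤-refl))
    where e = v , u , v<u , adj-sym G uv

  subdivideWalk : ∀ {m u v} → Walk (toGraph G) m u v → Walk X (m * suc k) (orig u) (orig v)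
  subdivideWalk nil         = nil
  subdivideWalk (cons uv w) = edge-walk uv ++ subdivideWalk w

-- Rounding positions of S_(k+1) to positions of S_(k′+1)

module Rounding (G : FinGraph) (k k′ : ℕ) (odd : parity (suc k) ≡ 1ℙ)
  (odd′ : parity (suc k′) ≡ 1ℙ) where

  private
    module Src = Subdivision G k
    module Tgt = Subdivision G k′
    b = suc k
    d = suc k′

  -- The subtraction-free form of |b * j - d * i| < b, together with equal parity.
  Rounded : ℕ → ℕ → Set
  Rounded i j = parity j ≡ parity i × b * j ≤ d * i + k × d * i ≤ b * j + k

  -- One of `quo` and `suc quo` has the right parity. If the remainder is zero, it is `quo`, because
  -- `b` and `d` are odd; otherwise `suc quo` is also close enough.
  round : ∀ i → ∃ (Rounded i)
  round i = candidates (parity quo ℙ.≟ parity i)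
    where
    quo = (d * i) / b
    rem = (d * i) % b
    division : d * i ≡ b * quo + rem
    division = trans (m≡m%n+[m/n]*n (d * i) b) (trans (+-comm rem _) (cong (_+ rem) (*-comm quo b)))
    rem≤k : rem ≤ k
    rem≤k = s≤s⁻¹ (m%n<n (d * i) b)
    rem≢0 : parity quo ≢ parity i → rem ≢ 0
    rem≢0 differ rem≡0 = differ (begin
      parity quo       ≡⟨ parity-*-odd quo b odd ⟨
      parity (quo * b) ≡⟨ cong parity (*-comm quo b) ⟩
      parity (b * quo) ≡⟨ cong parity (trans division (trans (cong (b * quo +_) rem≡0) (+-identityʳ _))) ⟨
      parity (d * i)   ≡⟨ cong parity (*-comm d i) ⟩
      parity (i * d)   ≡⟨ parity-*-odd i d odd′ ⟩
      parity i         ∎)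
      where open ≡.≡-Reasoning
    open ≤-Reasoning
    candidates : _ → ∃ (Rounded i)
    candidates (yes same) = quo , same , lower , upper
      where
      lower : b * quo ≤ d * i + k
      lower = begin
        b * quo           ≤⟨ m≤m+n (b * quo) rem ⟩
        b * quo + rem     ≡⟨ division ⟨
        d * i             ≤⟨ m≤m+n (d * i) k ⟩
        d * i + k         ∎
      upper : d * i ≤ b * quo + k
      upper = begin
        d * i         ≡⟨ division ⟩
        b * quo + rem ≤⟨ +-monoʳ-≤ (b * quo) rem≤k ⟩
        b * quo + k   ∎
    candidates (no differ) = suc quo , trans (parity-suc quo) (≢⇒⁻¹≡ differ) , lower , upper
      where
      lower : b * suc quo ≤ d * i + k
      lower = begin
        b * suc quo         ≡⟨ *-suc b quo ⟩
        b + b * quo         ≡⟨ +-comm b (b * quo) ⟩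
        b * quo + (1 + k)   ≤⟨ +-monoʳ-≤ (b * quo) (+-monoˡ-≤ k (n≢0⇒n>0 (rem≢0 differ))) ⟩
        b * quo + (rem + k) ≡⟨ +-assoc (b * quo) rem k ⟨
        b * quo + rem + k   ≡⟨ cong (_+ k) division ⟨
        d * i + k           ∎
      upper : d * i ≤ b * suc quo + k
      upper = begin
        d * i           ≡⟨ division ⟩
        b * quo + rem   ≤⟨ +-mono-≤ (*-monoʳ-≤ b (n≤1+n quo)) rem≤k ⟩
        b * suc quo + k ∎

  position : ℕ → ℕ
  position i = proj₁ (round i)

  position≤ : ∀ (i : Fin k) → position (suc (toℕ i)) ≤ d
  position≤ i with j , _ , lower , _ ← round (suc (toℕ i)) = s≤s⁻¹ (*-cancelˡ-< b j (suc d) (begin-strict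
      b * j                 ≤⟨ lower ⟩
      d * suc (toℕ i) + k   ≤⟨ +-monoˡ-≤ k (*-monoʳ-≤ d (Fin.toℕ<n i)) ⟩
      d * k + k             ≡⟨ trans (+-comm (d * k) k) (*-comm (suc d) k) ⟩
      k * suc d             <⟨ *-monoˡ-< (suc d) (n<1+n k) ⟩
      b * suc d             ∎))
    where open ≤-Reasoning

  relocate : V Src.X → V Tgt.X
  relocate (orig u)    = orig u
  relocate (inner e i) = Tgt.point e (position (suc (toℕ i)))

  -- On the head side both distances are complements in the odd totals `d` and `b`, so parity
  -- carries over and the rounding error changes sign: here `upper` gives the bound.
  relocate-end : ∀ {x w α} → Src.End x w α →
    ∃ λ α′ → Walk Tgt.X α′ (relocate x) (orig w) × parity α′ ≡ parity α × b * α′ ≤ d * α + k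
  relocate-end Src.stop = 0 , nil , refl , ≤-trans (≤-reflexive (*-zeroʳ b)) z≤n
  relocate-end (Src.toTail {e} {i} refl) with round (suc (toℕ i)) | position≤ i
  ... | j , same , lower , _ | j≤d = j , reverse S-sym (Tgt.point-walk e 0 j j≤d) , same , lower
  relocate-end (Src.toHead {e} {i} {α} eq) with round (suc (toℕ i)) | position≤ i
  ... | j , same , lower , upper | j≤d =
    α′ , subst (Walk Tgt.X α′ (Tgt.point e j)) (trans (cong (Tgt.point e) j+α′≡d) (Tgt.point-end e))
           (Tgt.point-walk e j α′ (≤-reflexive j+α′≡d)) ,
    parity-cancel-+ j (suc (toℕ i)) same
      (trans (cong parity j+α′≡d) (trans odd′ (trans (≡.sym odd) (cong parity (≡.sym eq))))) ,
    +-cancelˡ-≤ (b * j) _ _ (begin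
      b * j + b * α′                ≡⟨ *-distribˡ-+ b j α′ ⟨
      b * (j + α′)                  ≡⟨ cong (b *_) j+α′≡d ⟩
      b * d                         ≡⟨ *-comm b d ⟩
      d * b                         ≡⟨ cong (d *_) eq ⟨
      d * (suc (toℕ i) + α)         ≡⟨ *-distribˡ-+ d (suc (toℕ i)) α ⟩
      d * suc (toℕ i) + d * α       ≤⟨ +-monoˡ-≤ (d * α) upper ⟩
      b * j + k + d * α             ≡⟨ +-assoc (b * j) k (d * α) ⟩
      b * j + (k + d * α)           ≡⟨ cong (b * j +_) (+-comm k (d * α)) ⟩
      b * j + (d * α + k)           ∎)
    where
    open ≤-Reasoning
    α′ = d ∸ j
    j+α′≡d : j + α′ ≡ d
    j+α′≡d = m+[n∸m]≡n j≤d

  -- Each endpoint contributes a rounding error of at most `k`.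
  Relocated : V Src.X → V Src.X → ℕ → Set
  Relocated x y ℓ = ∃ λ ℓ′ → Walk Tgt.X ℓ′ (relocate x) (relocate y) ×
                    parity ℓ′ ≡ parity ℓ × b * ℓ′ ≤ d * ℓ + (k + k)

  relocated-sym : ∀ {x y} ℓ → Relocated x y ℓ → Relocated y x ℓ
  relocated-sym _ (ℓ′ , w , rest) = ℓ′ , reverse S-sym w , rest

  relocate-along : ∀ e (i j : Fin k) {ℓ} → toℕ i + ℓ ≡ toℕ j → Relocated (inner e i) (inner e j) ℓ
  relocate-along e i j {ℓ} eq with round (suc (toℕ i)) | position≤ i | round (suc (toℕ j)) | position≤ j
  ... | i′ , same-i , lower-i , upper-i | i′≤d | j′ , same-j , lower-j , upper-j | j′≤d with ≤-total i′ j′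
  ...   | inj₁ i′≤j′ =
    ℓ′ , subst (Walk Tgt.X ℓ′ (Tgt.point e i′)) (cong (Tgt.point e) i′+ℓ′≡j′)
           (Tgt.point-walk e i′ ℓ′ (≤-trans (≤-reflexive i′+ℓ′≡j′) j′≤d)) ,
    parity-cancel-+ i′ (suc (toℕ i)) same-i
      (trans (cong parity i′+ℓ′≡j′) (trans same-j (cong (parity ∘ suc) (≡.sym eq)))) ,
    +-cancelˡ-≤ (b * i′) _ _ (begin
      b * i′ + b * ℓ′                 ≡⟨ *-distribˡ-+ b i′ ℓ′ ⟨
      b * (i′ + ℓ′)                   ≡⟨ cong (b *_) i′+ℓ′≡j′ ⟩
      b * j′                          ≤⟨ lower-j ⟩
      d * suc (toℕ j) + k             ≡⟨ cong (λ l → d * suc l + k) eq ⟨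
      d * (suc (toℕ i) + ℓ) + k       ≡⟨ cong (_+ k) (*-distribˡ-+ d (suc (toℕ i)) ℓ) ⟩
      d * suc (toℕ i) + d * ℓ + k     ≤⟨ +-monoˡ-≤ k (+-monoˡ-≤ (d * ℓ) upper-i) ⟩
      b * i′ + k + d * ℓ + k          ≡⟨ regroup (b * i′) k (d * ℓ) ⟩
      b * i′ + (d * ℓ + (k + k))      ∎)
    where
    open ≤-Reasoning
    ℓ′ = j′ ∸ i′
    i′+ℓ′≡j′ : i′ + ℓ′ ≡ j′
    i′+ℓ′≡j′ = m+[n∸m]≡n i′≤j′
    regroup : ∀ x k y → x + k + y + k ≡ x + (y + (k + k))
    regroup = solve-∀
  -- Rounding to a prescribed parity may reverse the order; then `b * ℓ′` is at most the two errors
  -- `k + k`.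
  ...   | inj₂ j′≤i′ =
    ℓ′ , reverse S-sym (subst (Walk Tgt.X ℓ′ (Tgt.point e j′)) (cong (Tgt.point e) j′+ℓ′≡i′)
           (Tgt.point-walk e j′ ℓ′ (≤-trans (≤-reflexive j′+ℓ′≡i′) i′≤d))) ,
    ≡.sym (parity-cancel-+ (ℓ + suc (toℕ i)) j′ (≡.sym (trans same-j (cong parity eq′))) 
      (trans (cong parity (doubled (suc (toℕ i)) ℓ))
        (trans (parity-cong-+ (ℓ + ℓ) 0 {n′ = suc (toℕ i)} (parity-double ℓ) refl)
          (trans (≡.sym same-i) (cong parity (≡.sym j′+ℓ′≡i′)))))) ,
    +-cancelˡ-≤ (b * j′) _ _ (begin
      b * j′ + b * ℓ′                 ≡⟨ *-distribˡ-+ b j′ ℓ′ ⟨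
      b * (j′ + ℓ′)                   ≡⟨ cong (b *_) j′+ℓ′≡i′ ⟩
      b * i′                          ≤⟨ lower-i ⟩
      d * suc (toℕ i) + k             ≤⟨ +-monoˡ-≤ k (*-monoʳ-≤ d (s≤s (subst (toℕ i ≤_) eq (m≤m+n (toℕ i) ℓ)))) ⟩
      d * suc (toℕ j) + k             ≤⟨ +-monoˡ-≤ k upper-j ⟩
      b * j′ + k + k                  ≡⟨ +-assoc (b * j′) k k ⟩
      b * j′ + (k + k)                ≤⟨ +-monoʳ-≤ (b * j′) (m≤n+m (k + k) (d * ℓ)) ⟩
      b * j′ + (d * ℓ + (k + k))      ∎)
    where
    open ≤-Reasoning
    ℓ′ = i′ ∸ j′
    j′+ℓ′≡i′ : j′ + ℓ′ ≡ i′
    j′+ℓ′≡i′ = m+[n∸m]≡n j′≤i′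
    eq′ : suc (toℕ j) ≡ ℓ + suc (toℕ i)
    eq′ = trans (cong suc (≡.sym eq)) (+-comm (suc (toℕ i)) ℓ)
    doubled : ∀ x ℓ → ℓ + x + ℓ ≡ ℓ + ℓ + x
    doubled = solve-∀

  -- Whole edges scale exactly from `b` to `d`, so only the two end segments contribute errors.
  relocate-route : ∀ {x y ℓ} → Src.Route x y ℓ → Relocated x y ℓ
  relocate-route (Src.along (inj₁ eq)) = relocate-along _ _ _ eq
  relocate-route {ℓ = ℓ} (Src.along (inj₂ eq)) = relocated-sym ℓ (relocate-along _ _ _ eq)
  relocate-route (Src.through {α = α} {m} {β} x→w w→w′ y→w′ refl)
    with α′ , u , same-α , bound-α ← relocate-end x→w
       | β′ , v , same-β , bound-β ← relocate-end y→w′ =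
    α′ + m * d + β′ , (u ++ Tgt.subdivideWalk w→w′) ++ reverse S-sym v ,
    parity-cong-+ (α′ + m * d) (α + m * b)
      (parity-cong-+ α′ α same-α (trans (parity-*-odd m d odd′) (≡.sym (parity-*-odd m b odd)))) same-β ,
    (begin
      b * (α′ + m * d + β′)                     ≡⟨ expand b α′ m d β′ ⟩
      b * α′ + b * β′ + m * d * b               ≤⟨ +-monoˡ-≤ (m * d * b) (+-mono-≤ bound-α bound-β) ⟩
      (d * α + k) + (d * β + k) + m * d * b     ≡⟨ collect d α k β m b ⟩
      d * (α + m * b + β) + (k + k)             ∎)
    where
    open ≤-Reasoning
    expand : ∀ b α m d β → b * (α + m * d + β) ≡ b * α + b * β + m * d * b
    expand = solve-∀
    collect : ∀ d α k β m b → (d * α + k) + (d * β + k) + m * d * b ≡ d * (α + m * b + β) + (k + k)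
    collect = solve-∀

  -- The total error `k + k` is below `2 * b`, so `ℓ′ < 2 + c`; both being odd, `ℓ′ ≤ c`, and
  -- `lengthen` fills the rest.
  rounding : ∀ {a c} → parity a ≡ 1ℙ → parity c ≡ 1ℙ → a * d ≤ c * b → (Src.X ^^ a) ⟶ (Tgt.X ^^ c)
  rounding {a} {c} a-odd c-odd ad≤cb = relocate , hom
    where
    hom : ∀ {x y} → Walk Src.X a x y → Walk Tgt.X c (relocate x) (relocate y)
    hom w with ℓ , route , ℓ≤a , same ← Src.walk⇒route w
          with ℓ′ , w′ , same′ , bound ← relocate-route route =
      lengthen S-sym ℓ′-odd c-odd (parity≡⇒≤ (trans ℓ′-odd (≡.sym c-odd))
        (*-cancelˡ-< b ℓ′ (2 + c) (begin-strict
        b * ℓ′            ≤⟨ bound ⟩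
        d * ℓ + (k + k)   ≤⟨ +-monoˡ-≤ (k + k) (*-monoʳ-≤ d ℓ≤a) ⟩
        d * a + (k + k)   ≡⟨ cong (_+ (k + k)) (*-comm d a) ⟩
        a * d + (k + k)   ≤⟨ +-monoˡ-≤ (k + k) ad≤cb ⟩
        c * b + (k + k)   <⟨ +-monoʳ-< (c * b) (+-mono-< (n<1+n k) (n<1+n k)) ⟩
        c * b + (b + b)   ≡⟨ factor c b ⟩
        b * (2 + c)       ∎))) w′
      where
      open ≤-Reasoning
      ℓ′-odd : parity ℓ′ ≡ 1ℙ
      ℓ′-odd = trans same′ (trans same a-odd)
      factor : ∀ c b → c * b + (b + b) ≡ b * (2 + c)
      factor = solve-∀

-- Comparison of the two powers through the common subdivision into `b * d` parts.

theorem2p7 : (G : FinGraph) → ¬ Bipartite G → (g : ℕ) → IsOddGirth G g →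
    (r s p q : ℕ) → oddFrac r s < oddFrac p q → oddFrac p q < ℕtoℚᵘ g →
    (frac G r s ⟶ frac G p q) × ¬ (frac G p q ⟶ frac G r s)
theorem2p7 G _ g girth r s p q a/b<c/d c/d<g =
  Rounding.rounding G (2 * s) (2 * q) b-odd d-odd a-odd c-odd (<⇒≤ ad<cb) , noHom
  where
  a = suc (2 * r)
  b = suc (2 * s)
  c = suc (2 * p)
  d = suc (2 * q)
  -- suc K is definitionally b * d.
  K = 2 * q + 2 * s * d
  a-odd = parity-odd r
  b-odd = parity-odd s
  c-odd = parity-odd p
  d-odd = parity-odd q

  ad<cb : a * d ℕ.< c * b
  ad<cb = drop‿+<+ (drop-*<* a/b<c/d)

  c<gd : c ℕ.< g * d
  c<gd = subst (ℕ._< g * d) (*-identityʳ c)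
    (drop‿+<+ (subst (ℤ.+ (c * 1) ℤ.<_) (≡.sym (pos-* g d)) (drop-*<* c/d<g)))

  g-odd : parity g ≡ 1ℙ
  g-odd = trans (cong parity (proj₂ (proj₁ girth))) (parity-odd (proj₁ (proj₁ girth)))

  bd-odd : parity (b * d) ≡ 1ℙ
  bd-odd = trans (parity-*-odd b d d-odd) b-odd

  ad-odd : parity (a * d) ≡ 1ℙ
  ad-odd = trans (parity-*-odd a d d-odd) a-odd

  cb-odd : parity (c * b) ≡ 1ℙ
  cb-odd = trans (parity-*-odd c b b-odd) c-odd

  open Subdivision G K using (X; closedWalk⇒closedWalk; subdivideWalk)

  -- A loop would yield an odd closed walk of `G`, of length at least `g`, hence
  -- `g * (b * d) ≤ a * d`; but the two hypotheses give `a * d < c * b < g * d * b`.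
  loopless : ∀ x → ¬ Walk X (a * d) x x
  loopless x w with m , _ , w′ , m-odd , m*bd≤ad ← closedWalk⇒closedWalk bd-odd ad-odd w =
    <-irrefl refl (begin-strict
      g * (b * d)  ≤⟨ *-monoˡ-≤ (b * d) (oddGirth≤ G girth m-odd w′) ⟩
      m * (b * d)  ≤⟨ m*bd≤ad ⟩
      a * d        <⟨ ad<cb ⟩
      c * b        <⟨ *-monoˡ-< b c<gd ⟩
      g * d * b    ≡⟨ trans (*-assoc g d b) (cong (g *_) (*-comm d b)) ⟩
      g * (b * d)  ∎)
    where open ≤-Reasoning

  -- Both products are odd, so the strict inequality leaves a gap of two: the slack in
  -- `no-shrinking`.
  2+ad≤cb : 2 + a * d ≤ c * b
  2+ad≤cb = ≮⇒≥ λ cb<2+ad → <⇒≱ ad<cb (parity≡⇒≤ (trans cb-odd (≡.sym ad-odd)) cb<2+ad)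

  -- As exponents of `G`, (2 + ad)/(bd) is at most cb/(bd) = c/d; in `refine`, a/b and ad/(bd) are
  -- equal.
  coarsen : (X ^^ (2 + a * d)) ⟶ frac G p q
  coarsen = Rounding.rounding G K (2 * q) bd-odd d-odd {2 + a * d} ad-odd c-odd
    (≤-trans (*-monoˡ-≤ d 2+ad≤cb) (≤-reflexive (*-assoc c b d)))

  refine : frac G r s ⟶ (X ^^ (a * d))
  refine = Rounding.rounding G (2 * s) K b-odd bd-odd a-odd ad-odd
    (≤-reflexive (trans (cong (a *_) (*-comm b d)) (≡.sym (*-assoc a d b))))

  noHom : ¬ (frac G p q ⟶ frac G r s)
  noHom f with x , w ← cycle⇒closedWalk G (proj₁ (proj₂ girth))
          with h′ , eq ← parity-1⇒Odd (g * (b * d)) (trans (parity-*-odd g (b * d) bd-odd) g-odd) =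
    -- The odd closed walk is the subdivided shortest odd cycle, of length `g * (b * d)`.
    no-shrinking {X} S-sym {a * d} loopless (enumerate G (suc K)) h′
      (recount (trans eq (cong suc (*-comm 2 h′))) (subdivideWalk w))
      (proj₁ refine ∘ proj₁ f ∘ proj₁ coarsen , proj₂ refine ∘ proj₂ f ∘ proj₂ coarsen)
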